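{- Let $\lambda$ be any partition of length $3$ (i.e. $\lambda=(\lambda_1\ge\lambda_2\ge\lambda_3)$ with positive integer parts). Then the $q,t$-Catalan number $C_\lambda(q,t)$ is $q,t$-symmetric, i.e. $C_\lambda(q,t)=C_\lambda(t,q)$ as polynomials in $q,t$.
   Context: For a vector $\vec{k}=(k_1,k_2,k_3)$ of positive integers, a $\vec{k}$-Dyck path is a lattice path starting and ending at level $0$ and never going below level $0$, consisting of three red up steps of heights $k_1,k_2,k_3$ (in this order, the first being the first step of the path) and $k_1+k_2+k_3$ blue down steps of height $1$. The red ranks $(r_1,r_2,r_3)$ of the path are the levels at which the three red steps start, so $r_1=0$. The set $\mathcal{D}_{\vec{k}}$ of $\vec{k}$-Dyck paths is in bijection, via red ranks, with the set of integer pairs $(r_2,r_3)$ such that $0\le r_2\le k_1$ and $0\le r_3\le r_2+k_2$. For $D\in\mathcal{D}_{\vec{k}}$ with red ranks $(0,r_2,r_3)$, the statistics area and bounce are $$\mathrm{area}(D)=r_2+r_3,$$ $$\mathrm{bounce}(D)=\begin{cases}2(k_1-r_2)+r_2+k_2-r_3-\min(r_2,k_2), & \text{if } r_2+k_2-r_3\ge 2\min(r_2,k_2),\\[2pt] 2(k_1-r_2)+\left\lceil \frac{r_2+k_2-r_3}{2}\right\rceil, & \text{otherwise.}\end{cases}$$ Set $$C_{\vec{k}}(q,t)=\sum_{D\in\mathcal{D}_{\vec{k}}}q^{\mathrm{area}(D)}t^{\mathrm{bounce}(D)}.$$ For a vector $\vec{k}$ of positive integers, let $\lambda(\vec{k})$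 be the partition obtained by arranging the entries of $\vec{k}$ in decreasing (weakly) order. For a partition $\lambda$ of length $3$, $$C_\lambda(q,t)=\sum_{\vec{k}:\ \lambda(\vec{k})=\lambda}C_{\vec{k}}(q,t),$$ the sum being over the distinct vectors $\vec{k}\in\mathbb{Z}_{>0}^3$ with $\lambda(\vec{k})=\lambda$. -}

module Defs where

open import Data.Bool.Base using (if_then_else_)
open import Data.List.Base
  using (List; []; _∷_; [_]; _++_; map; concatMap; filter; length; upTo; cartesianProductWith)
open import Data.List.Membership.Propositional using (_∈_)
open import Data.List.Membership.Propositional.Properties
  using (∈-map⁺; ∈-map⁻; ∈-++⁺ˡ; ∈-++⁺ʳ; ∈-filter⁺; ∈-filter⁻; ∈-upTo⁺;
         ∈-cartesianProductWith⁺; ∈-cartesianProductWith⁻)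
open import Data.List.Properties using () renaming (≡-dec to List-≡-dec)
open import Data.List.Relation.Binary.Permutation.Propositional using (↭-sym)
open import Data.List.Relation.Binary.Permutation.Propositional.Properties using (∈-resp-↭)
open import Data.List.Relation.Unary.Any using (here; there)
import Data.List.Relation.Unary.All as ListAll
import Data.List.Relation.Unary.AllPairs as AllPairs
open import Data.List.Relation.Unary.Unique.Propositional using (Unique)
import Data.List.Relation.Unary.Unique.Propositional.Properties as Unique
open import Data.List.Sort.Base using (SortingAlgorithm)
import Data.List.Sort.InsertionSort as InsertionSort
open import Data.Nat.Base
  using (ℕ; zero; suc; _+_; _*_; _∸_; _⊓_; _≤_; _≥_; _≤ᵇ_; ⌈_/2⌉; z≤n; s≤s)
open import Data.Nat.Properties using (_≟_; ≤-decTotalOrder; ≤-refl; ≤-trans; suc-injective)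
open import Data.Product.Base using (_×_; _,_; swap)
open import Data.Product.Properties using () renaming (≡-dec to ×-≡-dec)
open import Data.Vec.Base using (Vec; []; _∷_; toList)
open import Data.Vec.Properties using (∷-injective)
open import Data.Vec.Relation.Unary.All using (All; []; _∷_)
open import Relation.Binary.Construct.Flip.EqAndOrd using (decTotalOrder)
open import Relation.Binary.PropositionalEquality using (_≡_; refl; subst)
open import Relation.Nullary.Negation.Core using (¬_)

infix  4 _≈_
infix  9 q^_t^_

------------------------------------------------------------------------
-- Polynomials in q and t with coefficients in ℕ

-- Finite formal sums: the pair (a , b) stands for the monomial qᵃtᵇ, addition
-- is _++_, and a coefficient c is a monomial repeated c times.  As _≡_ on lists
-- is sensitive to the order of the terms, polynomials are compared with _≈_.

ℕ[q,t] : Set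
ℕ[q,t] = List (ℕ × ℕ)

q^_t^_ : ℕ → ℕ → ℕ × ℕ
q^ a t^ b = a , b

coefficient : ℕ[q,t] → ℕ → ℕ → ℕ
coefficient f a b = length (filter (λ m → ×-≡-dec _≟_ _≟_ m (q^ a t^ b)) f)

_≈_ : ℕ[q,t] → ℕ[q,t] → Set
f ≈ g = ∀ a b → coefficient f a b ≡ coefficient g a b

-- f(q,t) ↦ f(t,q)
exchange : ℕ[q,t] → ℕ[q,t]
exchange = map swap

------------------------------------------------------------------------
-- Dyck paths

-- Path h ks: the lattice paths from level h to level 0 which never go below
-- level 0, with red up steps of heights ks (in this order) and blue down steps
-- of height 1.  Levels force the number of blue steps to be h plus the sum
-- of ks, and force a path from level 0 to begin with a red step.

data Path : ∀ {n} → ℕ → Vec ℕ n → Set where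
  end  : Path 0 []
  red  : ∀ {n h k} {ks : Vec ℕ n} → Path (h + k) ks → Path h (k ∷ ks)
  blue : ∀ {n h} {ks : Vec ℕ n} → Path h ks → Path (suc h) ks

Dyck : Vec ℕ 3 → Set
Dyck k = Path 0 k

redRanks : ∀ {n h} {ks : Vec ℕ n} → Path h ks → Vec ℕ n
redRanks end             = []
redRanks (red {h = h} p) = h ∷ redRanks p
redRanks (blue p)        = redRanks p

paths : ∀ {n} h (ks : Vec ℕ n) → List (Path h ks)
paths zero    []       = [ end ]
paths (suc h) []       = map blue (paths h [])
paths zero    (k ∷ ks) = map red (paths k ks)
paths (suc h) (k ∷ ks) = map red (paths (suc h + k) ks) ++ map blue (paths h (k ∷ ks))

∈-paths : ∀ {n h} {ks : Vec ℕ n} (p : Path h ks) → p ∈ paths h ks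
∈-paths end                              = here refl
∈-paths (red {h = zero} p)               = ∈-map⁺ red (∈-paths p)
∈-paths (red {h = suc h} p)              = ∈-++⁺ˡ (∈-map⁺ red (∈-paths p))
∈-paths (blue {ks = []} p)               = ∈-map⁺ blue (∈-paths p)
∈-paths (blue {h = h} {ks = k ∷ ks} p)   =
  ∈-++⁺ʳ (map red (paths (suc h + k) ks)) (∈-map⁺ blue (∈-paths p))

paths-unique : ∀ {n} h (ks : Vec ℕ n) → Unique (paths h ks)
paths-unique zero    []       = ListAll.[] AllPairs.∷ AllPairs.[]
paths-unique (suc h) []       = Unique.map⁺ (λ { refl → refl }) (paths-unique h [])
paths-unique zero    (k ∷ ks) = Unique.map⁺ (λ { refl → refl }) (paths-unique k ks)
paths-unique (suc h) (k ∷ ks) = Unique.++⁺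
  (Unique.map⁺ (λ { refl → refl }) (paths-unique (suc h + k) ks))
  (Unique.map⁺ (λ { refl → refl }) (paths-unique h (k ∷ ks)))
  disjoint
  where
  disjoint : ∀ {p} → ¬ (p ∈ map red (paths (suc h + k) ks) × p ∈ map blue (paths h (k ∷ ks)))
  disjoint (r , b) with ∈-map⁻ red r | ∈-map⁻ blue b
  ... | _ , _ , refl | _ , _ , ()

------------------------------------------------------------------------
-- Statistics

area : ∀ {k} → Dyck k → ℕ
area D with redRanks D
... | _ ∷ r₂ ∷ r₃ ∷ [] = r₂ + r₃

-- Every subtraction is exact, as r₂ ≤ k₁ and r₃ ≤ r₂ + k₂.
bounceOfRanks : (k₁ k₂ r₂ r₃ : ℕ) → ℕ
bounceOfRanks k₁ k₂ r₂ r₃ =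
  if 2 * (r₂ ⊓ k₂) ≤ᵇ (r₂ + k₂ ∸ r₃)
  then 2 * (k₁ ∸ r₂) + (r₂ + k₂ ∸ r₃ ∸ r₂ ⊓ k₂)
  else 2 * (k₁ ∸ r₂) + ⌈ r₂ + k₂ ∸ r₃ /2⌉

bounce : ∀ {k} → Dyck k → ℕ
bounce {k₁ ∷ k₂ ∷ _ ∷ []} D with redRanks D
... | _ ∷ r₂ ∷ r₃ ∷ [] = bounceOfRanks k₁ k₂ r₂ r₃

------------------------------------------------------------------------
-- Catalan polynomials

catalan : Vec ℕ 3 → ℕ[q,t]
catalan k = map (λ D → q^ area D t^ bounce D) (paths 0 k)

open SortingAlgorithm (InsertionSort.insertionSort (decTotalOrder ≤-decTotalOrder))
  using () renaming (sort to sort↓; sort-↭ to sort↓-↭) public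

partition : ∀ {n} → Vec ℕ n → List ℕ
partition k = sort↓ (toList k)

vectors : (n m : ℕ) → List (Vec ℕ n)
vectors zero    m = [ [] ]
vectors (suc n) m = cartesianProductWith _∷_ (map suc (upTo m)) (vectors n m)

-- The vectors of positive integers with partition l₁ ≥ l₂ ≥ l₃; their entries
-- are among those of the partition, hence at most l₁.
rearrangements : (l₁ l₂ l₃ : ℕ) → List (Vec ℕ 3)
rearrangements l₁ l₂ l₃ =
  filter (λ k → List-≡-dec _≟_ (partition k) (l₁ ∷ l₂ ∷ l₃ ∷ [])) (vectors 3 l₁)

partitionCatalan : (l₁ l₂ l₃ : ℕ) → ℕ[q,t]
partitionCatalan l₁ l₂ l₃ = concatMap catalan (rearrangements l₁ l₂ l₃)

vectors-unique : ∀ n m → Unique (vectors n m)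
vectors-unique zero    m = ListAll.[] AllPairs.∷ AllPairs.[]
vectors-unique (suc n) m = Unique.cartesianProductWith⁺ _∷_ ∷-injective
  (Unique.map⁺ suc-injective (Unique.upTo⁺ m)) (vectors-unique n m)

rearrangements-unique : ∀ l₁ l₂ l₃ → Unique (rearrangements l₁ l₂ l₃)
rearrangements-unique l₁ l₂ l₃ =
  Unique.filter⁺ (λ k → List-≡-dec _≟_ (partition k) (l₁ ∷ l₂ ∷ l₃ ∷ [])) (vectors-unique 3 l₁)

∈-vectors⁺ : ∀ {n m} {k : Vec ℕ n} → All (1 ≤_) k → (∀ {x} → x ∈ toList k → x ≤ m) → k ∈ vectors n m
∈-vectors⁺ {k = []}        []          b = here refl
∈-vectors⁺ {k = suc x ∷ k} (s≤s _ ∷ p) b = ∈-cartesianProductWith⁺ _∷_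
  (∈-map⁺ suc (∈-upTo⁺ (b (here refl)))) (∈-vectors⁺ p (λ i → b (there i)))

∈-vectors⁻ : ∀ {n m} {k : Vec ℕ n} → k ∈ vectors n m → All (1 ≤_) k
∈-vectors⁻ {zero}  {m} {[]} _ = []
∈-vectors⁻ {suc n} {m} i with ∈-cartesianProductWith⁻ _∷_ (map suc (upTo m)) (vectors n m) i
... | _ , _ , x∈ , k∈ , refl with ∈-map⁻ suc x∈
...   | _ , _ , refl = s≤s z≤n ∷ ∈-vectors⁻ {m = m} k∈

∈-rearrangements⁺ : ∀ {l₁ l₂ l₃} {k : Vec ℕ 3} → l₁ ≥ l₂ → l₂ ≥ l₃ →
                    All (1 ≤_) k → partition k ≡ l₁ ∷ l₂ ∷ l₃ ∷ [] → k ∈ rearrangements l₁ l₂ l₃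
∈-rearrangements⁺ {l₁} {l₂} {l₃} {k} l₁≥l₂ l₂≥l₃ positive eq =
  ∈-filter⁺ (λ k → List-≡-dec _≟_ (partition k) (l₁ ∷ l₂ ∷ l₃ ∷ []))
    (∈-vectors⁺ positive (λ {x} i →
      bounded (subst (x ∈_) eq (∈-resp-↭ (↭-sym (sort↓-↭ (toList k))) i)))) eq
  where
  bounded : ∀ {x} → x ∈ l₁ ∷ l₂ ∷ l₃ ∷ [] → x ≤ l₁
  bounded (here refl)                 = ≤-refl
  bounded (there (here refl))         = l₁≥l₂
  bounded (there (there (here refl))) = ≤-trans l₂≥l₃ l₁≥l₂

∈-rearrangements⁻ : ∀ {l₁ l₂ l₃} {k : Vec ℕ 3} → k ∈ rearrangements l₁ l₂ l₃ →
                    All (1 ≤_) k × partition k ≡ l₁ ∷ l₂ ∷ l₃ ∷ []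
∈-rearrangements⁻ {l₁} {l₂} {l₃} i
  with k∈ , eq ← ∈-filter⁻ (λ k → List-≡-dec _≟_ (partition k) (l₁ ∷ l₂ ∷ l₃ ∷ [])) {xs = vectors 3 l₁} i
  = ∈-vectors⁻ {m = l₁} k∈ , eq

{-# OPTIONS --safe #-}

-- Each C_k(q,t) is already symmetric, for k = (a, b, c).  Write (x, y) for the
-- last two red ranks.
--
-- If y + b ≤ x, put x = b + z + y and a = x + n: the area is b + z + 2y and the
-- bounce is b + z + 2n, so that exchanging y and n exchanges the statistics.
--
-- The remaining pairs correspond to numbers d ≤ a, d < b and p + q = 2n + (b − d),
-- where n = a − d, with area d + p and bounce d + q; exchange p and q.
--
-- The statistics together with z (0 in the second case) determine the pair, so
-- the involution can be read off these triples.

module Submission where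

open import Data.Bool.Properties using (T-≡; ¬-not)
open import Data.Empty using (⊥; ⊥-elim)
open import Data.List.Base using (List; []; _∷_; map; concatMap)
open import Data.List.Membership.Propositional using (_∈_)
open import Data.List.Membership.Propositional.Properties using (∈-map⁺; ∈-map⁻)
open import Data.List.Membership.Propositional.Properties.WithK using (unique∧set⇒bag)
open import Data.List.Properties using (map-∘; map-cong; map-concatMap)
open import Data.List.Relation.Binary.BagAndSetEquality using (∼bag⇒↭)
open import Data.List.Relation.Binary.Permutation.Propositional
  using (_↭_; ↭-refl; ↭-trans; ↭-reflexive; module PermutationReasoning)
open import Data.List.Relation.Binary.Permutation.Propositional.Properties
  using (map⁺; ++⁺; filter-↭; ↭-length)
open import Data.List.Relation.Unary.Unique.Propositional using (Unique)
import Data.List.Relation.Unary.Unique.Propositional.Properties as Unique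
open import Data.Nat.Base
  using (zero; suc; _+_; _*_; _∸_; _⊓_; _≤_; _<_; _≤′_; ≤′-refl; ≤′-step; _≤ᵇ_;
         ⌊_/2⌋; ⌈_/2⌉; z≤n; s≤s)
open import Data.Nat.Properties
open import Data.Nat.Tactic.RingSolver using (solve-∀)
open import Data.Product.Base using (∃; _×_; _,_; proj₂; swap; map₂)
open import Data.Product.Properties using (,-injective)
open import Data.Vec.Base using (Vec; []; _∷_; head)
open import Data.Vec.Properties using (∷-injectiveʳ)
open import Function.Base using (_∘_)
open import Function.Bundles using (Equivalence; mk⇔)
open import Relation.Binary.PropositionalEquality
  using (_≡_; refl; sym; trans; cong; cong₂; subst)
open import Relation.Nullary.Decidable using (yes; no)
open import Relation.Nullary.Negation using (contradiction)

open import Defs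
open import Data.Nat using (ℕ; _≥_)

-- Arithmetic: witnesses of inequalities, parity and halving.

≤-witness : ∀ {m n} k → m + k ≡ n → m ≤ n
≤-witness {m} k eq = ≤-trans (m≤m+n m k) (≤-reflexive eq)

double-cancel-< : ∀ {m n} → m + m < n + n → m < n
double-cancel-< m+m<n+n = ≰⇒> λ n≤m → <⇒≱ m+m<n+n (+-mono-≤ n≤m n≤m)

∸-unique : ∀ m {n o} → m + n ≡ o → o ∸ m ≡ n
∸-unique m {n} refl = m+n∸m≡n m n

data Half : ℕ → Set where
  even : ∀ i → Half (i + i)
  odd  : ∀ i → Half (suc (i + i))

half : ∀ n → Half n
half zero = even 0
half (suc n) with half n
... | even i = odd i
... | odd i  = subst Half (cong suc (+-suc i i)) (even (suc i))

-- Past `c` every two units raise both ranks of `highRanks` by one, so an excess is recorded by its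
-- half and its parity; the parity tells which rank received the last unit.
data Position (c : ℕ) : ℕ → Set where
  within      : ∀ {p} → p ≤ c → Position c p
  beyond-odd  : ∀ i → Position c (c + suc (i + i))
  beyond-even : ∀ i → Position c (c + suc (suc (i + i)))

position : ∀ c p → Position c p
position c p with p ≤? c
... | yes p≤c = within p≤c
... | no p≰c with m≤n⇒∃[o]m+o≡n (≰⇒> p≰c)
...   | e , refl with half e
...     | even i = subst (Position c) (+-suc c (i + i)) (beyond-odd i)
...     | odd i  = subst (Position c) (+-suc c (suc (i + i))) (beyond-even i)

-- The two cases of the bounce, free of subtraction.

-- Writing x + k₂ - y as `μ + μ + r` with `μ` the minimum encodes the condition of the first case:
-- `r` is the surplus over twice the minimum.
bounceOfRanks-≥ : ∀ {k₁ k₂ x y} n r {μ} → x + n ≡ k₁ → x ⊓ k₂ ≡ μ →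
                  y + (μ + μ + r) ≡ x + k₂ → bounceOfRanks k₁ k₂ x y ≡ n + n + (μ + r)
bounceOfRanks-≥ {k₁} {k₂} {x} {y} n r {μ} k₁≡ refl m≡
  rewrite ∸-unique y m≡ | ∸-unique x k₁≡
        | Equivalence.to T-≡ (≤⇒≤ᵇ (≤-witness {2 * μ} r (cong (λ k → μ + k + r) (+-identityʳ μ))))
        = cong₂ _+_ (cong (n +_) (+-identityʳ n)) (∸-unique μ (sym (+-assoc μ μ r)))

bounceOfRanks-< : ∀ {k₁ k₂ x y} n m → x + n ≡ k₁ → y + m ≡ x + k₂ →
                  m < 2 * (x ⊓ k₂) → bounceOfRanks k₁ k₂ x y ≡ n + n + ⌈ m /2⌉
bounceOfRanks-< {k₁} {k₂} {x} {y} n m k₁≡ m≡ m<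
  rewrite ∸-unique y m≡ | ∸-unique x k₁≡
        | ¬-not {2 * (x ⊓ k₂) ≤ᵇ m} (λ t → <⇒≱ m< (≤ᵇ⇒≤ _ _ (Equivalence.from T-≡ t)))
        = cong (λ k → n + k + ⌈ m /2⌉) (+-identityʳ n)

-- Keys and coordinates of pairs of red ranks.

-- The first component is z; the truncated subtraction makes it 0 when x < y + b.
key : ℕ → ℕ → ℕ × ℕ → ℕ × ℕ × ℕ
key a b (x , y) = x ∸ (y + b) , x + y , bounceOfRanks a b x y

-- `n` is a - x in `low` and a - d in `high`; `suc c` is b - d, which builds in d < b. The equations
-- that tie y to n and p to q are symmetric, so exchanging these numbers stays inside the type.
data Coordinates (a b : ℕ) : Set where
  low  : ∀ z y n → b + z + y + n ≡ a → Coordinates a b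
  high : ∀ d c n p q → d + n ≡ a → d + suc c ≡ b → p + q ≡ n + n + suc c → Coordinates a b

-- For p ≤ c this is (d , p), and each further unit of p is added to the first
-- and to the second rank in turn; c stands for b − d.
highRanks : ℕ → ℕ → ℕ → ℕ × ℕ
highRanks d c p = d + ⌈ p ∸ c /2⌉ , p ⊓ c + ⌊ p ∸ c /2⌋

ranks : ∀ {a b} → Coordinates a b → ℕ × ℕ
ranks {b = b} (low z y n _)  = b + z + y , y
ranks (high d c n p q _ _ _) = highRanks d (suc c) p

-- The key in a form where the exchange of the statistics is visible; `key-ranks` identifies it with
-- `key`.
coordinateKey : ∀ {a b} → Coordinates a b → ℕ × ℕ × ℕ
coordinateKey {b = b} (low z y n _)  = z , b + z + y + y , b + z + n + n
coordinateKey (high d c n p q _ _ _) = 0 , d + p , d + q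

reflect : ∀ {a b} → Coordinates a b → Coordinates a b
reflect {b = b} (low z y n eq) = low z n y (trans (swap-last (b + z) n y) eq)
  where
  swap-last : ∀ m n y → m + n + y ≡ m + y + n
  swap-last = solve-∀
reflect (high d c n p q a≡ b≡ eq) = high d c n q p a≡ b≡ (trans (+-comm q p) eq)

coordinateKey-reflect : ∀ {a b} (u : Coordinates a b) →
                        coordinateKey (reflect u) ≡ map₂ swap (coordinateKey u)
coordinateKey-reflect (low _ _ _ _)          = refl
coordinateKey-reflect (high _ _ _ _ _ _ _ _) = refl

-- Area and bounce computed in coordinates.

highRanks-within : ∀ {d c p} → p ≤ c → highRanks d c p ≡ (d , p)
highRanks-within {d} {c} {p} p≤c rewrite m≤n⇒m∸n≡0 p≤c | m≤n⇒m⊓n≡m p≤c =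
  cong₂ _,_ (+-identityʳ d) (+-identityʳ p)

highRanks-beyond : ∀ {d c} e → highRanks d c (c + e) ≡ (d + ⌈ e /2⌉ , c + ⌊ e /2⌋)
highRanks-beyond {d} {c} e rewrite m+n∸m≡n c e | m≥n⇒m⊓n≡n (m≤m+n c e) = refl

highRanks-odd : ∀ d c i → highRanks d c (c + suc (i + i)) ≡ (d + suc i , c + i)
highRanks-odd d c i = trans (highRanks-beyond (suc (i + i)))
  (sym (cong₂ (λ u v → d + suc u , c + v) (n≡⌊n+n/2⌋ i) (n≡⌈n+n/2⌉ i)))

highRanks-even : ∀ d c i → highRanks d c (c + suc (suc (i + i))) ≡ (d + suc i , c + suc i)
highRanks-even d c i = trans (highRanks-beyond (suc (suc (i + i))))
  (sym (cong₂ (λ u v → d + suc u , c + suc v) (n≡⌈n+n/2⌉ i) (n≡⌊n+n/2⌋ i)))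

double-< : ∀ {m n} → n < m → suc (n + n) < 2 * m
double-< {m} {n} n<m = ≤-trans (≤-reflexive (eq n)) (*-monoʳ-≤ 2 n<m)
  where
  eq : ∀ n → suc (suc (n + n)) ≡ 2 * suc n
  eq = solve-∀

-- Here x ≥ b, so the minimum is b, and x + b - y = 2b + z: the first case of the bounce with
-- surplus z.
key-low : ∀ b z y n → key (b + z + y + n) b (b + z + y , y) ≡ (z , b + z + y + y , b + z + n + n)
key-low b z y n = cong₂ _,_ (∸-unique (y + b) (eq₁ b z y)) (cong (b + z + y + y ,_)
  (trans (bounceOfRanks-≥ {y = y} n z refl (m≥n⇒m⊓n≡n (≤-witness (z + y) (sym (+-assoc b z y)))) (eq₂ b z y))
         (eq₃ b z n)))
  where
  eq₁ : ∀ b z y → y + b + z ≡ b + z + y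
  eq₁ = solve-∀
  eq₂ : ∀ b z y → y + (b + b + z) ≡ b + z + y + b
  eq₂ = solve-∀
  eq₃ : ∀ b z n → n + n + (b + z) ≡ b + z + n + n
  eq₃ = solve-∀

-- With c = p + r the minimum is d and x + b - y = 2d + r: the first case of the bounce with surplus
-- r, while q = 2n + r.
key-within : ∀ d n c p q → p ≤ c → p + q ≡ n + n + c → key (d + n) (d + c) (d , p) ≡ (0 , d + p , d + q)
key-within d n c p q p≤c p+q≡ with m≤n⇒∃[o]m+o≡n p≤c
... | r , refl = cong₂ _,_ (m≤n⇒m∸n≡0 (≤-witness (p + (p + r)) (eq₁ d p r))) (cong (d + p ,_)
  (trans (bounceOfRanks-≥ {y = p} n r refl (m≤n⇒m⊓n≡m (m≤m+n d (p + r))) (eq₂ d p r))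
         (trans (eq₃ d n r) (cong (d +_) (sym q≡)))))
  where
  eq₁ : ∀ d p r → d + (p + (p + r)) ≡ p + (d + (p + r))
  eq₁ = solve-∀
  eq₂ : ∀ d p r → p + (d + d + r) ≡ d + (d + (p + r))
  eq₂ = solve-∀
  eq₃ : ∀ d n r → n + n + (d + r) ≡ d + (n + n + r)
  eq₃ = solve-∀
  eq₄ : ∀ n p r → n + n + (p + r) ≡ p + (n + n + r)
  eq₄ = solve-∀
  q≡ : q ≡ n + n + r
  q≡ = +-cancelˡ-≡ p _ _ (trans p+q≡ (eq₄ n p r))

-- Beyond `c`, x + b - y is 2d or 2d + 1; since both x and b exceed d, it lies below twice their
-- minimum, which selects the second case of the bounce.
d<⊓ : ∀ d c i → d < (d + suc i) ⊓ (d + suc c)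
d<⊓ d c i = ⊓-glb (m<m+n d (s≤s z≤n)) (m<m+n d (s≤s z≤n))

-- With p = c + e, the numbers e and q share 2n. This bounds e and so keeps the first rank at most
-- a.
excess-cancel : ∀ {c e q n} → c + e + q ≡ n + n + c → e + q ≡ n + n
excess-cancel {c} {e} {q} {n} eq =
  +-cancelˡ-≡ c _ _ (trans (sym (+-assoc c e q)) (trans eq (+-comm (n + n) c)))

-- Now x + b - y = 2d + 1, whose half rounds up to d + 1. With m = n - i - 1 = a - x this gives
-- bounce 2m + d + 1, and q = 2m + 1.
key-odd : ∀ d n c i q → suc c + suc (i + i) + q ≡ n + n + suc c →
          key (d + n) (d + suc c) (d + suc i , suc c + i) ≡ (0 , d + (suc c + suc (i + i)) , d + q)
key-odd d n c i q p+q≡ with excess-cancel {suc c} {suc (i + i)} {q} {n} p+q≡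
... | e+q≡ with m≤n⇒∃[o]m+o≡n (double-cancel-< {i} {n} (≤-witness q e+q≡))
...   | m , refl = cong₂ _,_ (m≤n⇒m∸n≡0 (≤-witness {d + suc i} (c + suc c) (eq₁ d c i))) (cong₂ _,_ (eq₂ d c i)
  (trans (bounceOfRanks-< {y = suc c + i} m (suc (d + d)) (eq₃ d i m) (eq₄ d c i) (double-< (d<⊓ d c i)))
         (trans (cong (λ k → m + m + suc k) (sym (n≡⌊n+n/2⌋ d))) (trans (eq₅ d m) (cong (d +_) (sym q≡))))))
  where
  eq₁ : ∀ d c i → d + suc i + (c + suc c) ≡ suc c + i + (d + suc c)
  eq₁ = solve-∀
  eq₂ : ∀ d c i → d + suc i + (suc c + i) ≡ d + (suc c + suc (i + i))
  eq₂ = solve-∀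
  eq₃ : ∀ d i m → d + suc i + m ≡ d + suc (i + m)
  eq₃ = solve-∀
  eq₄ : ∀ d c i → suc c + i + suc (d + d) ≡ d + suc i + (d + suc c)
  eq₄ = solve-∀
  eq₅ : ∀ d m → m + m + suc d ≡ d + suc (m + m)
  eq₅ = solve-∀
  eq₆ : ∀ i m → suc (i + m) + suc (i + m) ≡ suc (i + i) + suc (m + m)
  eq₆ = solve-∀
  q≡ : q ≡ suc (m + m)
  q≡ = +-cancelˡ-≡ (suc (i + i)) _ _ (trans e+q≡ (eq₆ i m))

-- As in the odd case, but x + b - y = 2d, so the bounce is 2m + d and q = 2m.
key-even : ∀ d n c i q → suc c + suc (suc (i + i)) + q ≡ n + n + suc c →
           key (d + n) (d + suc c) (d + suc i , suc c + suc i) ≡ (0 , d + (suc c + suc (suc (i + i))) , d + q)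
key-even d n c i q p+q≡ with excess-cancel {suc c} {suc (suc (i + i))} {q} {n} p+q≡
... | e+q≡ with m≤n⇒∃[o]m+o≡n (double-cancel-< {i} {n} (≤-witness {suc (i + i)} (suc q) (trans (+-suc _ q) e+q≡)))
...   | m , refl = cong₂ _,_ (m≤n⇒m∸n≡0 (≤-witness (suc c + suc c) (eq₁ d c i))) (cong₂ _,_ (eq₂ d c i)
  (trans (bounceOfRanks-< {y = suc c + suc i} m (d + d) (eq₃ d i m) (eq₄ d c i)
          (<-trans (n<1+n (d + d)) (double-< (d<⊓ d c i))))
         (trans (cong (m + m +_) (sym (n≡⌈n+n/2⌉ d))) (trans (eq₅ d m) (cong (d +_) (sym q≡))))))
  where
  eq₁ : ∀ d c i → d + suc i + (suc c + suc c) ≡ suc c + suc i + (d + suc c)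
  eq₁ = solve-∀
  eq₂ : ∀ d c i → d + suc i + (suc c + suc i) ≡ d + (suc c + suc (suc (i + i)))
  eq₂ = solve-∀
  eq₃ : ∀ d i m → d + suc i + m ≡ d + suc (i + m)
  eq₃ = solve-∀
  eq₄ : ∀ d c i → suc c + suc i + (d + d) ≡ d + suc i + (d + suc c)
  eq₄ = solve-∀
  eq₅ : ∀ d m → m + m + d ≡ d + (m + m)
  eq₅ = solve-∀
  eq₆ : ∀ i m → suc (i + m) + suc (i + m) ≡ suc (suc (i + i)) + (m + m)
  eq₆ = solve-∀
  q≡ : q ≡ m + m
  q≡ = +-cancelˡ-≡ (suc (suc (i + i))) _ _ (trans e+q≡ (eq₆ i m))

key-ranks : ∀ {a b} (u : Coordinates a b) → key a b (ranks u) ≡ coordinateKey u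
key-ranks {b = b} (low z y n refl) = key-low b z y n
key-ranks (high d c n p q refl refl p+q≡) with position (suc c) p
... | within p≤c    = trans (cong (key _ _) (highRanks-within p≤c)) (key-within d n (suc c) p q p≤c p+q≡)
... | beyond-odd i  = trans (cong (key _ _) (highRanks-odd d (suc c) i)) (key-odd d n c i q p+q≡)
... | beyond-even i = trans (cong (key _ _) (highRanks-even d (suc c) i)) (key-even d n c i q p+q≡)

-- Recovering the ranks from the key.

halve-≡ : ∀ {m n} → m + m ≡ n + n → m ≡ n
halve-≡ {m} {n} eq = trans (n≡⌊n+n/2⌋ m) (trans (cong ⌊_/2⌋ eq) (sym (n≡⌊n+n/2⌋ n)))

low-total : ∀ b z y n → (b + z + y + y) + (b + z + n + n) ≡ (b + z + y + n) + (b + z + y + n)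
low-total = solve-∀

-- For fixed a and b, this makes the sum of area and bounce determine d.
high-total : ∀ {a b} d c n p q → d + n ≡ a → d + c ≡ b → p + q ≡ n + n + c →
             d + ((d + p) + (d + q)) ≡ a + a + b
high-total d c n p q refl refl p+q≡ = trans (eq₁ d p q) (trans (cong (d + d + d +_) p+q≡) (eq₂ d c n))
  where
  eq₁ : ∀ d p q → d + ((d + p) + (d + q)) ≡ d + d + d + (p + q)
  eq₁ = solve-∀
  eq₂ : ∀ d c n → d + d + d + (n + n + c) ≡ d + n + (d + n) + (d + c)
  eq₂ = solve-∀

-- Area and bounce add up to 2a on low coordinates, and to more on high ones.
low≢high : ∀ {a b z y n d c m p q} → b + z + y + n ≡ a → d + m ≡ a → d + suc c ≡ b →
           p + q ≡ m + m + suc c → b + z + y + y ≡ d + p → b + z + n + n ≡ d + q → ⊥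
low≢high {a} {b} {z} {y} {n} {d} {c} {m} {p} {q} refl a≡ b≡ p+q≡ area≡ bounce≡ =
  m+1+n≢m d (trans b≡ (sym (+-cancelʳ-≡ (a + a) d b
    (trans (cong (d +_) (trans (sym (low-total b z y n)) (cong₂ _+_ area≡ bounce≡)))
      (trans (high-total d (suc c) m p q a≡ b≡ p+q≡) (+-comm (a + a) b))))))

-- For two low coordinates, z can be read off and the area then gives y. For two high ones, the
-- total gives d, then the area gives p and b gives c. The mixed cases contradict `low≢high`.
coordinateKey-determines-ranks : ∀ {a b} (u v : Coordinates a b) →
                                 coordinateKey u ≡ coordinateKey v → ranks u ≡ ranks v
coordinateKey-determines-ranks {b = b} (low z y n _) (low z′ y′ n′ _) eq
  with refl , eq′ ← ,-injective eq
  with area≡ , _ ← ,-injective eq′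
  with refl ← halve-≡ {y} {y′} (+-cancelˡ-≡ (b + z) _ _
                (trans (sym (+-assoc (b + z) y y)) (trans area≡ (+-assoc (b + z) y′ y′))))
  = refl
coordinateKey-determines-ranks (low z y n a≡) (high d c m p q a≡′ b≡ p+q≡) eq
  with area≡ , bounce≡ ← ,-injective (cong proj₂ eq)
  = ⊥-elim (low≢high {z = z} {y} {n} {d} {c} a≡ a≡′ b≡ p+q≡ area≡ bounce≡)
coordinateKey-determines-ranks (high d c m p q a≡′ b≡ p+q≡) (low z y n a≡) eq
  with area≡ , bounce≡ ← ,-injective (cong proj₂ eq)
  = ⊥-elim (low≢high {z = z} {y} {n} {d} {c} a≡ a≡′ b≡ p+q≡ (sym area≡) (sym bounce≡))
coordinateKey-determines-ranks (high d c n p q a≡ b≡ p+q≡) (high d′ c′ n′ p′ q′ a≡′ b≡′ p+q≡′) eq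
  with area≡ , bounce≡ ← ,-injective (cong proj₂ eq)
  with refl ← +-cancelʳ-≡ ((d + p) + (d + q)) d d′
                (trans (high-total d (suc c) n p q a≡ b≡ p+q≡)
                  (trans (sym (high-total d′ (suc c′) n′ p′ q′ a≡′ b≡′ p+q≡′))
                    (cong (d′ +_) (sym (cong₂ _+_ area≡ bounce≡)))))
  with refl ← +-cancelˡ-≡ d _ _ area≡
  with refl ← +-cancelˡ-≡ d _ _ (trans b≡ (sym b≡′))
  = refl

-- Coordinates parametrise the admissible pairs.

Bounded : ℕ → ℕ → ℕ × ℕ → Set
Bounded a b (x , y) = x ≤ a × y ≤ x + b

ranks-bounded : ∀ {a b} (u : Coordinates a b) → Bounded a b (ranks u)
ranks-bounded {b = b} (low z y n eq) = ≤-trans (m≤m+n (b + z + y) n) (≤-reflexive eq) ,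
  ≤-trans (m≤n+m y (b + z)) (m≤m+n _ b)
ranks-bounded (high d c n p q refl refl p+q≡) with position (suc c) p
... | within p≤c = subst (Bounded _ _) (sym (highRanks-within p≤c))
  (m≤m+n d n , ≤-trans p≤c (≤-trans (m≤n+m (suc c) d) (m≤n+m _ d)))
... | beyond-odd i = subst (Bounded _ _) (sym (highRanks-odd d (suc c) i))
  ( +-monoʳ-≤ d (double-cancel-< {i} {n} (≤-witness q (excess-cancel {suc c} {suc (i + i)} {q} {n} p+q≡)))
  , ≤-witness (suc (d + d)) (eq d c i))
  where
  eq : ∀ d c i → suc c + i + suc (d + d) ≡ d + suc i + (d + suc c)
  eq = solve-∀
... | beyond-even i = subst (Bounded _ _) (sym (highRanks-even d (suc c) i))
  ( +-monoʳ-≤ d (double-cancel-< {i} {n} (≤-witness (suc q)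
      (trans (+-suc _ q) (excess-cancel {suc c} {suc (suc (i + i))} {q} {n} p+q≡))))
  , ≤-witness (d + d) (eq d c i))
  where
  eq : ∀ d c i → suc c + suc i + (d + d) ≡ d + suc i + (d + suc c)
  eq = solve-∀

-- This bound and the next make half of the excess x + y - b fit below x and y, so that d and c can
-- be recovered by subtraction.
excess≤x+x : ∀ {b x y e} → y ≤ x + b → x + y ≡ b + e → e ≤ x + x
excess≤x+x {b} {x} {y} {e} y≤x+b x+y≡ = +-cancelˡ-≤ b e (x + x) (begin
  b + e       ≡⟨ x+y≡ ⟨
  x + y       ≤⟨ +-monoʳ-≤ x y≤x+b ⟩
  x + (x + b) ≡⟨ +-assoc x x b ⟨
  x + x + b   ≡⟨ +-comm (x + x) b ⟩
  b + (x + x) ∎)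
  where open ≤-Reasoning

excess<y+y : ∀ {b x y e} → x < y + b → x + y ≡ b + e → e < y + y
excess<y+y {b} {x} {y} {e} x<y+b x+y≡ = +-cancelˡ-< b e (y + y) (begin-strict
  b + e       ≡⟨ x+y≡ ⟨
  x + y       <⟨ +-monoˡ-< y x<y+b ⟩
  y + b + y   ≡⟨ cong (_+ y) (+-comm y b) ⟩
  b + y + y   ≡⟨ +-assoc b y y ⟩
  b + (y + y) ∎)
  where open ≤-Reasoning

within⇒x<b : ∀ {b x y} → x < y + b → x + y ≤ b → x < b
within⇒x<b {b} {x} {y} x<y+b x+y≤b = double-cancel-< (begin-strict
  x + x       <⟨ +-monoʳ-< x x<y+b ⟩
  x + (y + b) ≡⟨ +-assoc x y b ⟨
  x + y + b   ≤⟨ +-monoˡ-≤ b x+y≤b ⟩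
  b + b       ∎)
  where open ≤-Reasoning

-- Since d + p = x + y and d + `suc c` = b, comparing p with `suc c` amounts to comparing x + y with
-- b. The sum is named `s` so that matching on its position can refine it.
high-coordinates : ∀ {a b x y s} → x ≤ a → y ≤ x + b → x < y + b → x + y ≡ s → Position b s →
                   ∃ λ (u : Coordinates a b) → ranks u ≡ (x , y)
high-coordinates {a} {b} {x} {y} x≤a y≤x+b x<y+b x+y≡ (within s≤b)
  with x+y≤b ← ≤-trans (≤-reflexive x+y≡) s≤b
  with c , refl ← m≤n⇒∃[o]m+o≡n (within⇒x<b x<y+b x+y≤b)
  with n , a≡ ← m≤n⇒∃[o]m+o≡n x≤a
  with y≤c ← +-cancelˡ-≤ x y (suc c) (≤-trans x+y≤b (≤-reflexive (sym (+-suc x c))))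
  with r , y+r≡ ← m≤n⇒∃[o]m+o≡n y≤c
  = high x c n y (n + n + r) a≡ (+-suc x c) (trans (eq n r y) (cong (n + n +_) y+r≡))
  , highRanks-within y≤c
  where
  eq : ∀ n r y → y + (n + n + r) ≡ n + n + (y + r)
  eq = solve-∀
high-coordinates {a} {b} {x} {y} x≤a y≤x+b x<y+b x+y≡ (beyond-odd i)
  with d , refl ← m≤n⇒∃[o]m+o≡n (double-cancel-< {i} {x} (excess≤x+x {e = suc (i + i)} y≤x+b x+y≡))
  with c , refl ← m≤n⇒∃[o]m+o≡n (double-cancel-< {i} {y} (<⇒≤ (excess<y+y x<y+b x+y≡)))
  with n , refl ← m≤n⇒∃[o]m+o≡n x≤a
  -- The coordinate a - d is `suc i` plus a - x; p is x + y - d, and q is what remains of the total.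
  = high d c (suc i + n) (suc c + suc (i + i)) (suc (n + n)) (eq₁ d i n)
         (sym (+-cancelʳ-≡ (suc (i + i)) _ _ (trans (sym x+y≡) (eq₂ d c i)))) (eq₃ c i n)
  , trans (highRanks-odd d (suc c) i) (cong₂ _,_ (+-comm d (suc i)) (cong suc (+-comm c i)))
  where
  eq₁ : ∀ d i n → d + (suc i + n) ≡ suc i + d + n
  eq₁ = solve-∀
  eq₂ : ∀ d c i → suc i + d + (suc i + c) ≡ d + suc c + suc (i + i)
  eq₂ = solve-∀
  eq₃ : ∀ c i n → suc c + suc (i + i) + suc (n + n) ≡ suc i + n + (suc i + n) + suc c
  eq₃ = solve-∀
high-coordinates {a} {b} {x} {y} x≤a y≤x+b x<y+b x+y≡ (beyond-even i)
  with d , refl ← m≤n⇒∃[o]m+o≡n (double-cancel-< {i} {x} (<⇒≤ (excess≤x+x {e = suc (suc (i + i))} y≤x+b x+y≡)))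
  -- The excess is twice `suc i`, and its strict bound leaves room for y = `suc (suc i) + c`.
  with c , refl ← m≤n⇒∃[o]m+o≡n (double-cancel-< {suc i} {y}
                    (subst (_< y + y) (cong suc (sym (+-suc i i))) (excess<y+y x<y+b x+y≡)))
  with n , refl ← m≤n⇒∃[o]m+o≡n x≤a
  = high d c (suc i + n) (suc c + suc (suc (i + i))) (n + n) (eq₁ d i n)
         (sym (+-cancelʳ-≡ (suc (suc (i + i))) _ _ (trans (sym x+y≡) (eq₂ d c i)))) (eq₃ c i n)
  , trans (highRanks-even d (suc c) i) (cong₂ _,_ (+-comm d (suc i)) (cong suc (+-comm c (suc i))))
  where
  eq₁ : ∀ d i n → d + (suc i + n) ≡ suc i + d + n
  eq₁ = solve-∀
  eq₂ : ∀ d c i → suc i + d + (suc (suc i) + c) ≡ d + suc c + suc (suc (i + i))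
  eq₂ = solve-∀
  eq₃ : ∀ c i n → suc c + suc (suc (i + i)) + (n + n) ≡ suc i + n + (suc i + n) + suc c
  eq₃ = solve-∀

coordinates : ∀ {a b} r → Bounded a b r → ∃ λ (u : Coordinates a b) → ranks u ≡ r
coordinates {a} {b} (x , y) (x≤a , y≤x+b) with y + b ≤? x
... | no  y+b≰x = high-coordinates x≤a y≤x+b (≰⇒> y+b≰x) refl (position b (x + y))
... | yes y+b≤x with z , refl ← m≤n⇒∃[o]m+o≡n y+b≤x | n , refl ← m≤n⇒∃[o]m+o≡n x≤a
  = low z y n (cong (_+ n) (eq b z y)) , cong (_, y) (eq b z y)
  where
  eq : ∀ b z y → b + z + y ≡ y + b + z
  eq = solve-∀

-- Area and bounce alone would not suffice: on low coordinates, raising z by 2 while lowering y and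
-- n by 1 preserves both.
key-injective : ∀ {a b r s} → Bounded a b r → Bounded a b s → key a b r ≡ key a b s → r ≡ s
key-injective {r = r} {s} r-bounded s-bounded eq
  with u , refl ← coordinates r r-bounded | v , refl ← coordinates s s-bounded
  = coordinateKey-determines-ranks u v (trans (sym (key-ranks u)) (trans eq (key-ranks v)))

key-swap : ∀ {a b r} → Bounded a b r → ∃ λ s → Bounded a b s × key a b s ≡ map₂ swap (key a b r)
key-swap {r = r} r-bounded with u , refl ← coordinates r r-bounded
  = ranks (reflect u) , ranks-bounded (reflect u) ,
    trans (key-ranks (reflect u)) (trans (coordinateKey-reflect u) (cong (map₂ swap) (sym (key-ranks u))))

-- Dyck paths and their red ranks.

descend : ∀ {n h l} {ks : Vec ℕ n} → h ≤′ l → Path h ks → Path l ks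
descend ≤′-refl       p = p
descend (≤′-step h≤l) p = blue (descend h≤l p)

redRanks-descend : ∀ {n h l} {ks : Vec ℕ n} (h≤l : h ≤′ l) (p : Path h ks) →
                   redRanks (descend h≤l p) ≡ redRanks p
redRanks-descend ≤′-refl       p = refl
redRanks-descend (≤′-step h≤l) p = redRanks-descend h≤l p

redRanks-head : ∀ {n h k} {ks : Vec ℕ n} (p : Path h (k ∷ ks)) → head (redRanks p) ≤ h
redRanks-head (red p)  = ≤-refl
redRanks-head (blue p) = m≤n⇒m≤1+n (redRanks-head p)

-- A path that starts with a red step has its starting level as first rank; after a blue step the
-- first rank is smaller. Equal ranks thus force equal steps.
redRanks-injective : ∀ {n h} {ks : Vec ℕ n} (p p′ : Path h ks) → redRanks p ≡ redRanks p′ → p ≡ p′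
redRanks-injective end      end       eq = refl
redRanks-injective (red p)  (red p′)  eq = cong red (redRanks-injective p p′ (∷-injectiveʳ eq))
redRanks-injective (blue p) (blue p′) eq = cong blue (redRanks-injective p p′ eq)
redRanks-injective (red p)  (blue p′) eq =
  contradiction (≤-trans (≤-reflexive (cong head eq)) (redRanks-head p′)) 1+n≰n
redRanks-injective (blue p) (red p′)  eq =
  contradiction (≤-trans (≤-reflexive (cong head (sym eq))) (redRanks-head p)) 1+n≰n

secondThird : Vec ℕ 3 → ℕ × ℕ
secondThird (_ ∷ x ∷ y ∷ []) = x , y

rankPair : ∀ {a b c} → Dyck (a ∷ b ∷ c ∷ []) → ℕ × ℕ
rankPair D = secondThird (redRanks D)

decompose : ∀ {n h k} {ks : Vec ℕ n} (p : Path h (k ∷ ks)) →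
            ∃ λ x → x ≤ h × ∃ λ (p′ : Path (x + k) ks) → redRanks p ≡ x ∷ redRanks p′
decompose (red p)  = _ , ≤-refl , p , refl
decompose (blue p) with x , x≤h , p′ , eq ← decompose p = x , m≤n⇒m≤1+n x≤h , p′ , eq

rankPair-bounded : ∀ {a b c} (D : Dyck (a ∷ b ∷ c ∷ [])) → Bounded a b (rankPair D)
rankPair-bounded (red D)
  with x , x≤a , D′ , eq ← decompose D
  with y , y≤x+b , D″ , eq′ ← decompose D′
  with redRanks D | redRanks D′ | redRanks D″ | eq | eq′
... | _ | _ | [] | refl | refl = x≤a , y≤x+b

rankPair-injective : ∀ {a b c} {D D′ : Dyck (a ∷ b ∷ c ∷ [])} → rankPair D ≡ rankPair D′ → D ≡ D′
rankPair-injective {D = red D} {red D′} eq =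
  cong red (redRanks-injective D D′ (unpair (redRanks D) (redRanks D′) eq))
  where
  unpair : ∀ (v w : Vec ℕ 2) → secondThird (0 ∷ v) ≡ secondThird (0 ∷ w) → v ≡ w
  unpair (_ ∷ _ ∷ []) (_ ∷ _ ∷ []) refl = refl

rankPair-surjective : ∀ {a b c r} → Bounded a b r → ∃ λ (D : Dyck (a ∷ b ∷ c ∷ [])) → rankPair D ≡ r
rankPair-surjective {c = c} {r = x , y} (x≤a , y≤x+b) =
  -- Between red steps the path goes straight down to the prescribed level, one blue step for each
  -- step of `≤′`.
  red (descend (≤⇒≤′ x≤a) (red (descend (≤⇒≤′ y≤x+b) (red (descend z≤′n end))))) ,
  cong (λ v → secondThird (0 ∷ v)) (trans (redRanks-descend (≤⇒≤′ x≤a) _)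
    (cong (x ∷_) (trans (redRanks-descend (≤⇒≤′ y≤x+b) _) (cong (y ∷_) (redRanks-descend (z≤′n {y + c}) end)))))

weight≡key : ∀ {a b c} (D : Dyck (a ∷ b ∷ c ∷ [])) → (area D , bounce D) ≡ proj₂ (key a b (rankPair D))
weight≡key D with redRanks D
... | _ ∷ _ ∷ _ ∷ [] = refl

-- Symmetry of the Catalan polynomials.

-- Both lists are free of duplicates, so it is enough that they have the same elements.
map-involution-↭ : ∀ {A B : Set} {xs : List A} {f : A → B} {σ : B → B} → Unique xs →
                   (∀ {x y} → f x ≡ f y → x ≡ y) → (∀ y → σ (σ y) ≡ y) →
                   (∀ x → ∃ λ x′ → x′ ∈ xs × f x′ ≡ σ (f x)) → map f xs ↭ map (σ ∘ f) xs
map-involution-↭ {xs = xs} {f} {σ} unique inj invol closed =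
  ∼bag⇒↭ (unique∧set⇒bag (Unique.map⁺ inj unique) (Unique.map⁺ (inj ∘ σ-injective) unique) (mk⇔ to from))
  where
  σ-injective : ∀ {y z} → σ y ≡ σ z → y ≡ z
  σ-injective {y} {z} eq = trans (sym (invol y)) (trans (cong σ eq) (invol z))
  to : ∀ {y} → y ∈ map f xs → y ∈ map (σ ∘ f) xs
  to y∈ with x , _ , refl ← ∈-map⁻ f y∈ with x′ , x′∈ , eq ← closed x =
    -- As `σ` is an involution, `f x` is the image under `σ` of `f x′`.
    subst (_∈ map (σ ∘ f) xs) (trans (cong σ eq) (invol (f x))) (∈-map⁺ (σ ∘ f) x′∈)
  from : ∀ {y} → y ∈ map (σ ∘ f) xs → y ∈ map f xs
  from y∈ with x , _ , refl ← ∈-map⁻ (σ ∘ f) y∈ with x′ , x′∈ , eq ← closed x =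
    subst (_∈ map f xs) eq (∈-map⁺ f x′∈)

-- Monomials can repeat but keys cannot, so the permutation is found among keys and z is forgotten
-- afterwards.
catalan-symmetric : ∀ k → catalan k ↭ exchange (catalan k)
catalan-symmetric k@(a ∷ b ∷ c ∷ []) = begin
  catalan k                                             ≡⟨ catalan≡ ⟩
  map proj₂ (map pathKey (paths 0 k))                   ↭⟨ map⁺ proj₂ keys-symmetric ⟩
  map proj₂ (map (map₂ swap ∘ pathKey) (paths 0 k))     ≡⟨ map-∘ (paths 0 k) ⟨
  map (swap ∘ proj₂ ∘ pathKey) (paths 0 k)              ≡⟨ map-∘ (paths 0 k) ⟩
  exchange (map (proj₂ ∘ pathKey) (paths 0 k))          ≡⟨ cong exchange (map-∘ (paths 0 k)) ⟩
  exchange (map proj₂ (map pathKey (paths 0 k)))        ≡⟨ cong exchange catalan≡ ⟨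
  exchange (catalan k)                                  ∎
  where
  open PermutationReasoning
  pathKey : Dyck k → ℕ × ℕ × ℕ
  pathKey D = key a b (rankPair D)
  catalan≡ : catalan k ≡ map proj₂ (map pathKey (paths 0 k))
  catalan≡ = trans (map-cong weight≡key (paths 0 k)) (map-∘ (paths 0 k))
  closed : ∀ D → ∃ λ D′ → D′ ∈ paths 0 k × pathKey D′ ≡ map₂ swap (pathKey D)
  closed D with s , s-bounded , eq ← key-swap (rankPair-bounded D)
           with D′ , refl ← rankPair-surjective {c = c} s-bounded = D′ , ∈-paths D′ , eq
  keys-symmetric : map pathKey (paths 0 k) ↭ map (map₂ swap ∘ pathKey) (paths 0 k)
  keys-symmetric = map-involution-↭ {σ = map₂ swap} (paths-unique 0 k)
    (λ {D} {D′} eq → rankPair-injective (key-injective (rankPair-bounded D) (rankPair-bounded D′) eq))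
    (λ _ → refl) closed

concatMap⁺ : ∀ {A B : Set} {f g : A → List B} → (∀ x → f x ↭ g x) →
             ∀ xs → concatMap f xs ↭ concatMap g xs
concatMap⁺ f↭g []       = ↭-refl
concatMap⁺ f↭g (x ∷ xs) = ++⁺ (f↭g x) (concatMap⁺ f↭g xs)

↭⇒≈ : ∀ {f g} → f ↭ g → f ≈ g
↭⇒≈ f↭g a b = ↭-length (filter-↭ _ f↭g)

corollary2 : (l₁ l₂ l₃ : ℕ) → l₁ ≥ l₂ → l₂ ≥ l₃ → l₃ ≥ 1 →
    partitionCatalan l₁ l₂ l₃ ≈ exchange (partitionCatalan l₁ l₂ l₃)
corollary2 l₁ l₂ l₃ _ _ _ = ↭⇒≈ (↭-trans
  (concatMap⁺ catalan-symmetric (rearrangements l₁ l₂ l₃))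
  (↭-reflexive (sym (map-concatMap swap catalan (rearrangements l₁ l₂ l₃)))))
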